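{- Let $\mathcal{N}$ (with universe $N$) be a substructure of a structure $\mathcal{M}$ (with universe $M$) in a signature $\Sigma$. Then the following conditions are equivalent: (1) $\mathcal{N}$ is an elementary substructure of $\mathcal{M}$; (2) for any formula $\varphi(x_1,\ldots,x_n,y)$ of the signature $\Sigma$ and any elements $a_1,\ldots,a_n\in N$, if $\mathcal{M}\models\exists y\,\varphi(a_1,\ldots,a_n,y)$ then $\varphi(x_1,\ldots,x_n,y)$ is ($\forall$-) $\exists$-partially $(\{a_1\},\ldots,\{a_n\},N)$-preserving; (3) for any formula $\varphi(x_1,\ldots,x_n,y)$ of the signature $\Sigma$ and any elements $a_1,\ldots,a_n\in N$, either $\varphi(x_1,\ldots,x_n,y)$ is $(\{a_1\},\ldots,\{a_n\},M)$-disjoint or $\varphi(x_1,\ldots,x_n,y)$ is ($\forall$-) $\exists$-partially $(\{a_1\},\ldots,\{a_n\},N)$-preserving; (4) for any finite type $\Phi(x_1,\ldots,x_n,y)$ of the signature $\Sigma$ and any elements $a_1,\ldots,a_n\in N$, either $\Phi(x_1,\ldots,x_n,y)$ is $(\{a_1\},\ldots,\{a_n\},M)$-disjoint or $\Phi(x_1,\ldots,x_n,y)$ is ($\forall$-) $\exists$-partially $(\{a_1\},\ldots,\{a_n\},N)$-preserving.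
   Context: All preservation notions are taken in $\mathcal{M}$. For a type (set of formulas) $\Phi(x_1,\ldots,x_n,y)$, $\Phi(a_1,\ldots,a_n,\mathcal{M})$ is the set of all $b\in M$ such that $\mathcal{M}\models\varphi(a_1,\ldots,a_n,b)$ for all $\varphi\in\Phi$; a formula $\varphi$ is treated as the type $\{\varphi\}$. For $P_1,\ldots,P_n,Q\subseteq M$, $\Phi$ is $\exists$-partially (respectively $\forall$-partially) $(P_1,\ldots,P_n,Q)$-preserving if $\Phi(a_1,\ldots,a_n,\mathcal{M})\cap Q\neq\emptyset$ for some (respectively all) $a_1\in P_1,\ldots,a_n\in P_n$; for singletons $P_i=\{a_i\}$ the two notions coincide, and each may be used. $\Phi$ is $(\{a_1\},\ldots,\{a_n\},Q)$-disjoint if $\Phi(a_1,\ldots,a_n,\mathcal{M})\subseteq M\setminus Q$; in particular for $Q=M$ this says $\Phi(a_1,\ldots,a_n,\mathcal{M})=\emptyset$. -}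

module Defs where

open import Level using (Level; _⊔_) renaming (suc to lsuc)
open import Data.Empty.Polymorphic using (⊥)
open import Data.Fin.Base using (Fin)
open import Data.List.Base using (List)
open import Data.List.Membership.Propositional using () renaming (_∈_ to _∈ₗ_)
open import Data.Nat.Base using (ℕ; suc)
open import Data.Product.Base using (∃; _×_; _,_; proj₁)
open import Data.Sum.Base using (_⊎_)
open import Data.Vec.Base using (Vec; []; _∷_; map; lookup)
open import Function.Bundles using (_⇔_)
open import Relation.Binary.PropositionalEquality using (_≡_)
open import Relation.Nullary.Negation using (¬_)
open import Relation.Unary using (Pred; _∈_; _⊆_; _≐_; _∩_; ∁; U; ｛_｝; Satisfiable; Irrelevant)

private
  variable
    s ℓ p : Level
    n : ℕ

record Signature s : Set (lsuc s) where
  field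
    Func     : Set s
    Rel      : Set s
    funArity : Func → ℕ
    relArity : Rel → ℕ

module _ (𝕊 : Signature s) where
  open Signature 𝕊

  data Term (n : ℕ) : Set s where
    var : Fin n → Term n
    fun : (f : Func) → Vec (Term n) (funArity f) → Term n

  -- Formulas with free variables among n de Bruijn indices.  A quantifier binds
  -- index zero, so a formula φ(x₁,…,xₙ,y) is an element of Formula (suc n) in
  -- which y is index zero.
  data Formula (n : ℕ) : Set s where
    _≐′_           : Term n → Term n → Formula n
    rel            : (R : Rel) → Vec (Term n) (relArity R) → Formula n
    ⊥′             : Formula n
    ¬′_            : Formula n → Formula n
    _∧′_ _∨′_ _⇒′_ : Formula n → Formula n → Formula n
    ∃′_ ∀′_        : Formula (suc n) → Formula n

  record Structure ℓ : Set (s ⊔ lsuc ℓ) where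
    field
      Carrier : Set ℓ
      ⟦_⟧ᶠ    : (f : Func) → Vec Carrier (funArity f) → Carrier
      ⟦_⟧ʳ    : (R : Rel) → Vec Carrier (relArity R) → Set ℓ

open Structure using (Carrier)

data Mode : Set where
  ∃-partially ∀-partially : Mode

module _ {𝕊 : Signature s} where

  module _ (ℳ : Structure 𝕊 ℓ) where
    open Structure ℳ using (⟦_⟧ᶠ)

    mutual
      eval : Vec (Carrier ℳ) n → Term 𝕊 n → Carrier ℳ
      eval ρ (var i)    = lookup ρ i
      eval ρ (fun f ts) = ⟦ f ⟧ᶠ (evals ρ ts)

      evals : ∀ {k} → Vec (Carrier ℳ) n → Vec (Term 𝕊 n) k → Vec (Carrier ℳ) k
      evals ρ []       = []
      evals ρ (t ∷ ts) = eval ρ t ∷ evals ρ ts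

  infix 4 _⊨_[_]

  _⊨_[_] : (ℳ : Structure 𝕊 ℓ) → Formula 𝕊 n → Vec (Carrier ℳ) n → Set ℓ
  ℳ ⊨ t ≐′ u   [ ρ ] = eval ℳ ρ t ≡ eval ℳ ρ u
  ℳ ⊨ rel R ts [ ρ ] = Structure.⟦_⟧ʳ ℳ R (evals ℳ ρ ts)
  ℳ ⊨ ⊥′       [ ρ ] = ⊥
  ℳ ⊨ ¬′ φ     [ ρ ] = ¬ (ℳ ⊨ φ [ ρ ])
  ℳ ⊨ φ ∧′ ψ   [ ρ ] = ℳ ⊨ φ [ ρ ] × ℳ ⊨ ψ [ ρ ]
  ℳ ⊨ φ ∨′ ψ   [ ρ ] = ℳ ⊨ φ [ ρ ] ⊎ ℳ ⊨ ψ [ ρ ]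
  ℳ ⊨ φ ⇒′ ψ   [ ρ ] = ℳ ⊨ φ [ ρ ] → ℳ ⊨ ψ [ ρ ]
  ℳ ⊨ ∃′ φ     [ ρ ] = ∃ λ b → ℳ ⊨ φ [ b ∷ ρ ]
  ℳ ⊨ ∀′ φ     [ ρ ] = ∀ b → ℳ ⊨ φ [ b ∷ ρ ]

  -- Irrelevance makes the universe a genuine subset: equality in the induced
  -- structure below is then equality of the underlying elements of ℳ.
  record Substructure (ℳ : Structure 𝕊 ℓ) : Set (s ⊔ lsuc ℓ) where
    open Structure ℳ using (⟦_⟧ᶠ; ⟦_⟧ʳ)
    field
      universe   : Pred (Carrier ℳ) ℓ
      irrelevant : Irrelevant universe
      closed     : ∀ f (as : Vec (∃ universe) _) → ⟦ f ⟧ᶠ (map proj₁ as) ∈ universe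

    structure : Structure 𝕊 ℓ
    structure = record
      { Carrier = ∃ universe
      ; ⟦_⟧ᶠ    = λ f as → ⟦ f ⟧ᶠ (map proj₁ as) , closed f as
      ; ⟦_⟧ʳ    = λ R as → ⟦ R ⟧ʳ (map proj₁ as)
      }

  ElementarySubstructure : (ℳ : Structure 𝕊 ℓ) → Substructure ℳ → Set (s ⊔ ℓ)
  ElementarySubstructure ℳ 𝒩 = ∀ n (φ : Formula 𝕊 n) (as : Vec (Carrier structure) n) →
    structure ⊨ φ [ as ] ⇔ ℳ ⊨ φ [ map proj₁ as ]
    where open Substructure 𝒩 using (structure)

  -- A type Φ(x₁,…,xₙ,y) is an arbitrary set of formulas; no consistency is
  -- required.  The single formula φ is the type ｛ φ ｝.
  Type : ℕ → Set (lsuc s)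
  Type n = Pred (Formula 𝕊 (suc n)) s

  Finite : Type n → Set s
  Finite Φ = ∃ λ (φs : List _) → Φ ≐ (_∈ₗ φs)

  module _ (ℳ : Structure 𝕊 ℓ) where

    Solutions : Type n → Vec (Carrier ℳ) n → Pred (Carrier ℳ) (s ⊔ ℓ)
    Solutions Φ as b = ∀ φ → φ ∈ Φ → ℳ ⊨ φ [ b ∷ as ]

    Preserving : Mode → Type n → (Fin n → Pred (Carrier ℳ) ℓ) → Pred (Carrier ℳ) p → Set (s ⊔ ℓ ⊔ p)
    Preserving ∃-partially Φ P Q =
      ∃ λ as → (∀ i → lookup as i ∈ P i) × Satisfiable (Solutions Φ as ∩ Q)
    Preserving ∀-partially Φ P Q =
      ∀ as → (∀ i → lookup as i ∈ P i) → Satisfiable (Solutions Φ as ∩ Q)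

    -- ({a₁},…,{aₙ},Q)-disjointness, with the tuple of the aᵢ as argument.
    Disjoint : Type n → Vec (Carrier ℳ) n → Pred (Carrier ℳ) p → Set (s ⊔ ℓ ⊔ p)
    Disjoint Φ as Q = Solutions Φ as ⊆ ∁ Q

    singletons : Vec (Carrier ℳ) n → Fin n → Pred (Carrier ℳ) ℓ
    singletons as i = ｛ lookup as i ｝

  module _ (ℳ : Structure 𝕊 ℓ) (𝒩 : Substructure ℳ) (mode : Mode) where
    open Substructure 𝒩 renaming (universe to N)

    ExistentialsPreserve : Set (s ⊔ ℓ)
    ExistentialsPreserve = ∀ n (φ : Formula 𝕊 (suc n)) (as : Vec (∃ N) n) →
      let as′ = map proj₁ as in
      ℳ ⊨ ∃′ φ [ as′ ] → Preserving ℳ mode ｛ φ ｝ (singletons ℳ as′) N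

    FormulasDisjointOrPreserve : Set (s ⊔ ℓ)
    FormulasDisjointOrPreserve = ∀ n (φ : Formula 𝕊 (suc n)) (as : Vec (∃ N) n) →
      let as′ = map proj₁ as in
      Disjoint ℳ ｛ φ ｝ as′ U ⊎ Preserving ℳ mode ｛ φ ｝ (singletons ℳ as′) N

    FiniteTypesDisjointOrPreserve : Set (lsuc s ⊔ ℓ)
    FiniteTypesDisjointOrPreserve = ∀ n (Φ : Type n) → Finite Φ → (as : Vec (∃ N) n) →
      let as′ = map proj₁ as in
      Disjoint ℳ Φ as′ U ⊎ Preserving ℳ mode Φ (singletons ℳ as′) N

{-# OPTIONS --safe #-}

-- (1) ⇔ (2) is the Tarski–Vaught test, since preservation at a tuple of singletons
-- just says that Φ has a solution in N.  A finite type has the same solutions as the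
-- conjunction of its members, which reduces (4) to (3).
module Submission where

open import Defs
open import Level using (Level; Lift; lift; lower; _⊔_)
open import Axiom.ExcludedMiddle using (ExcludedMiddle)
open import Data.List.Base using (List; []; _∷_; [_]; foldr)
open import Data.List.Membership.Propositional using () renaming (_∈_ to _∈ₗ_)
open import Data.List.Relation.Unary.Any using (here; there)
open import Data.Nat.Base using (ℕ; suc)
open import Data.Product.Base as Product using (∃; _×_; _,_; proj₁; proj₂)
open import Data.Product.Function.NonDependent.Propositional using (_×-⇔_)
open import Data.Sum.Base as Sum using (_⊎_; inj₁; inj₂)
open import Data.Sum.Function.Propositional using (_⊎-⇔_)
open import Data.Unit.Base using (tt)
open import Data.Vec.Base using (Vec; []; _∷_; map; lookup; tabulate)
open import Data.Vec.Properties using (lookup-map; tabulate-cong; tabulate∘lookup)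
open import Function.Base using (_∘_)
open import Function.Bundles using (_⇔_; mk⇔; Equivalence)
open import Function.Properties.Equivalence using () renaming (refl to ⇔-refl; sym to ⇔-sym; trans to ⇔-trans)
open import Function.Related.TypeIsomorphisms using (¬-cong-⇔; →-cong-⇔)
open import Relation.Binary.PropositionalEquality using (_≡_; refl; sym; trans; cong; cong₂; subst)
open import Relation.Nullary.Decidable using (map′; yes; no)
open import Relation.Nullary.Negation using (contradiction)
open import Relation.Unary using (Pred; _≐_; _∩_; U; ｛_｝; Satisfiable)

open Equivalence using (to; from)
open Structure using (Carrier)

private
  variable
    s ℓ p : Level
    n : ℕ

-- Satisfaction lives in `Set ℓ`, and a proposition at that level is decided by deciding its lift.
excludedMiddle-lower : ∀ s → ExcludedMiddle (s ⊔ ℓ) → ExcludedMiddle ℓ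
excludedMiddle-lower s em = map′ lower (lift {ℓ = s}) em

lookup-injective : {A : Set ℓ} (as bs : Vec A n) → (∀ i → lookup as i ≡ lookup bs i) → as ≡ bs
lookup-injective as bs eq =
  trans (sym (tabulate∘lookup as)) (trans (tabulate-cong eq) (tabulate∘lookup bs))

-- The syntax has no constant for truth, so `¬′ ⊥′` serves as the empty conjunction.
⋀ : {𝕊 : Signature s} → List (Formula 𝕊 n) → Formula 𝕊 n
⋀ = foldr _∧′_ (¬′ ⊥′)

module _ {𝕊 : Signature s} (ℳ : Structure 𝕊 ℓ) where

  -- The only tuple with entries in the singletons is `as` itself, so quantifying over such tuples,
  -- existentially or universally, amounts to evaluating at `as`.
  preserving-singletons : ∀ mode (Φ : Type n) as (Q : Pred (Carrier ℳ) p) →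
    Preserving ℳ mode Φ (singletons ℳ as) Q ⇔ Satisfiable (Solutions ℳ Φ as ∩ Q)
  preserving-singletons ∃-partially Φ as Q = mk⇔
    (λ (as′ , eq , sat) →
      subst (λ v → Satisfiable (Solutions ℳ Φ v ∩ Q)) (sym (lookup-injective as as′ eq)) sat)
    (λ sat → as , (λ _ → refl) , sat)
  preserving-singletons ∀-partially Φ as Q = mk⇔
    (λ pres → pres as (λ _ → refl))
    (λ sat as′ eq →
      subst (λ v → Satisfiable (Solutions ℳ Φ v ∩ Q)) (lookup-injective as as′ eq) sat)

  solutions-singleton : (φ : Formula 𝕊 (suc n)) (as : Vec (Carrier ℳ) n) →
    Solutions ℳ ｛ φ ｝ as ≐ λ b → ℳ ⊨ φ [ b ∷ as ]
  solutions-singleton φ as = (λ sol → sol φ refl) , λ { sat _ refl → sat }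

  ⊨⋀⇔ : (φs : List (Formula 𝕊 n)) (ρ : Vec (Carrier ℳ) n) →
    ℳ ⊨ ⋀ φs [ ρ ] ⇔ (∀ φ → φ ∈ₗ φs → ℳ ⊨ φ [ ρ ])
  ⊨⋀⇔ []       ρ = mk⇔ (λ _ _ ()) (λ _ ())
  ⊨⋀⇔ (φ ∷ φs) ρ = mk⇔
    (λ { (sat , sats) _ (here refl) → sat
       ; (sat , sats) ψ (there ψ∈φs) → to (⊨⋀⇔ φs ρ) sats ψ ψ∈φs })
    (λ sats → sats φ (here refl) , from (⊨⋀⇔ φs ρ) (λ ψ → sats ψ ∘ there))

  solutions-⋀ : {Φ : Type n} ((φs , _) : Finite Φ) (as : Vec (Carrier ℳ) n) →
    Solutions ℳ ｛ ⋀ φs ｝ as ≐ Solutions ℳ Φ as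
  solutions-⋀ (φs , Φ⊆φs , φs⊆Φ) as =
    (λ {b} sol φ → to (⊨⋀⇔ φs (b ∷ as)) (sol _ refl) φ ∘ Φ⊆φs) ,
    (λ { {b} sol _ refl → from (⊨⋀⇔ φs (b ∷ as)) (λ φ → sol φ ∘ φs⊆Φ) })

  -- Disjointness is antitone in the solution set and preservation is monotone, so each disjunct
  -- uses one of the two inclusions.
  disjointOrPreserve-cong : ∀ mode {Φ Ψ : Type n} as (Q : Pred (Carrier ℳ) p) →
    Solutions ℳ Φ as ≐ Solutions ℳ Ψ as →
    Disjoint ℳ Φ as U ⊎ Preserving ℳ mode Φ (singletons ℳ as) Q →
    Disjoint ℳ Ψ as U ⊎ Preserving ℳ mode Ψ (singletons ℳ as) Q
  disjointOrPreserve-cong mode {Φ} {Ψ} as Q (Φ⊆Ψ , Ψ⊆Φ) = Sum.map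
    (λ disjoint → disjoint ∘ Ψ⊆Φ)
    (from (preserving-singletons mode Ψ as Q)
      ∘ Product.map₂ (Product.map₁ Φ⊆Ψ)
      ∘ to (preserving-singletons mode Φ as Q))

module _ {𝕊 : Signature s} (ℳ : Structure 𝕊 ℓ) (𝒩 : Substructure ℳ) where
  open Substructure 𝒩 renaming (universe to N; structure to 𝐍)

  mutual
    -- The inclusion of `𝐍` into `ℳ` is a homomorphism by the definition of the induced structure,
    -- so the function case is a congruence.
    proj₁-eval : ∀ (as : Vec (∃ N) n) t → proj₁ (eval 𝐍 as t) ≡ eval ℳ (map proj₁ as) t
    proj₁-eval as (var i)    = sym (lookup-map i proj₁ as)
    proj₁-eval as (fun f ts) = cong (Structure.⟦_⟧ᶠ ℳ f) (map-proj₁-evals as ts)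

    map-proj₁-evals : ∀ {k} (as : Vec (∃ N) n) (ts : Vec (Term 𝕊 n) k) →
      map proj₁ (evals 𝐍 as ts) ≡ evals ℳ (map proj₁ as) ts
    map-proj₁-evals as []       = refl
    map-proj₁-evals as (t ∷ ts) = cong₂ _∷_ (proj₁-eval as t) (map-proj₁-evals as ts)

  -- Irrelevance of membership makes the inclusion injective; this is what reflects equations from
  -- `ℳ` back to `𝐍`.
  proj₁-injective : {a b : ∃ N} → proj₁ a ≡ proj₁ b → a ≡ b
  proj₁-injective {a , a∈N} {a , a∈N′} refl = cong (a ,_) (irrelevant a∈N a∈N′)

  -- The Tarski-Vaught criterion: condition (2) with its mode and its singletons removed.
  WitnessesIn𝒩 : Set (s ⊔ ℓ)
  WitnessesIn𝒩 = ∀ n (φ : Formula 𝕊 (suc n)) (as : Vec (∃ N) n) →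
    ℳ ⊨ ∃′ φ [ map proj₁ as ] → Satisfiable ((λ b → ℳ ⊨ φ [ b ∷ map proj₁ as ]) ∩ N)

  -- Induction on formulas. Atoms and connectives pass along the inclusion; the criterion enters
  -- only where a quantifier ranges over all of `ℳ`, in one direction each for `∃′` and `∀′`.
  tarski-vaught : ExcludedMiddle ℓ → WitnessesIn𝒩 → ElementarySubstructure ℳ 𝒩
  tarski-vaught em witness = λ _ → elementary
    where
    elementary : ∀ {n} (φ : Formula 𝕊 n) as → 𝐍 ⊨ φ [ as ] ⇔ ℳ ⊨ φ [ map proj₁ as ]
    elementary (t ≐′ u) as = mk⇔
      (λ eq → trans (sym (proj₁-eval as t)) (trans (cong proj₁ eq) (proj₁-eval as u)))
      (λ eq → proj₁-injective (trans (proj₁-eval as t) (trans eq (sym (proj₁-eval as u)))))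
    elementary (rel R ts) as = mk⇔
      (subst (Structure.⟦_⟧ʳ ℳ R) (map-proj₁-evals as ts))
      (subst (Structure.⟦_⟧ʳ ℳ R) (sym (map-proj₁-evals as ts)))
    elementary ⊥′       as = ⇔-refl
    elementary (¬′ φ)   as = ¬-cong-⇔ (elementary φ as)
    elementary (φ ∧′ ψ) as = elementary φ as ×-⇔ elementary ψ as
    elementary (φ ∨′ ψ) as = elementary φ as ⊎-⇔ elementary ψ as
    elementary (φ ⇒′ ψ) as = →-cong-⇔ (elementary φ as) (elementary ψ as)
    elementary (∃′ φ)   as = mk⇔
      (λ (b , sat) → proj₁ b , to (elementary φ (b ∷ as)) sat)
      -- The given witness may lie outside `N`, where the induction hypothesis says nothing, so it
      -- is first exchanged for one in `N`.
      (λ sat → let (b , satᵇ , b∈N) = witness _ φ as sat in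
        (b , b∈N) , from (elementary φ ((b , b∈N) ∷ as)) satᵇ)
    elementary (∀′ φ)   as = mk⇔ forward
      (λ sat b → from (elementary φ (b ∷ as)) (sat (proj₁ b)))
      where
      forward : 𝐍 ⊨ ∀′ φ [ as ] → ℳ ⊨ ∀′ φ [ map proj₁ as ]
      -- A counterexample to `φ` in `ℳ` is a witness for `¬′ φ`. The criterion yields another one in
      -- `N`, where `φ` holds throughout.
      forward sat b with em {ℳ ⊨ φ [ b ∷ map proj₁ as ]}
      ... | yes satᵇ = satᵇ
      ... | no ¬satᵇ =
        let (c , ¬satᶜ , c∈N) = witness _ (¬′ φ) as (b , ¬satᵇ) in
        contradiction (to (elementary φ ((c , c∈N) ∷ as)) (sat (c , c∈N))) ¬satᶜ

  -- Elementarity is used twice: for `∃′ φ` to descend to `𝐍` and find a witness there, then for `φ`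
  -- at that witness to return to `ℳ`.
  elementary⇒witnesses : ElementarySubstructure ℳ 𝒩 → WitnessesIn𝒩
  elementary⇒witnesses elementary n φ as sat =
    let (b , satᵇ) = from (elementary n (∃′ φ) as) sat in
    proj₁ b , to (elementary (suc n) φ (b ∷ as)) satᵇ , proj₂ b

  module _ (mode : Mode) where

    preserve⇔witnesses : ExistentialsPreserve ℳ 𝒩 mode ⇔ WitnessesIn𝒩
    preserve⇔witnesses = mk⇔
      (λ preserve n φ as →
        Product.map₂ (Product.map₁ (proj₁ (solutions-singleton ℳ φ _)))
          ∘ to (preserving-singletons ℳ mode ｛ φ ｝ _ N)
          ∘ preserve n φ as)
      (λ witness n φ as →
        from (preserving-singletons ℳ mode ｛ φ ｝ _ N)
          ∘ Product.map₂ (Product.map₁ (proj₂ (solutions-singleton ℳ φ _)))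
          ∘ witness n φ as)

    elementary⇔preserve : ExcludedMiddle ℓ →
      ElementarySubstructure ℳ 𝒩 ⇔ ExistentialsPreserve ℳ 𝒩 mode
    elementary⇔preserve em =
      ⇔-trans (mk⇔ elementary⇒witnesses (tarski-vaught em)) (⇔-sym preserve⇔witnesses)

    preserve⇔disjointOrPreserve : ExcludedMiddle ℓ →
      ExistentialsPreserve ℳ 𝒩 mode ⇔ FormulasDisjointOrPreserve ℳ 𝒩 mode
    preserve⇔disjointOrPreserve em = mk⇔ forward backward
      where
      forward : ExistentialsPreserve ℳ 𝒩 mode → FormulasDisjointOrPreserve ℳ 𝒩 mode
      -- If the existential fails in `ℳ`, any solution would be a witness for it, so the solution
      -- set is empty.
      forward preserve n φ as with em {ℳ ⊨ ∃′ φ [ map proj₁ as ]}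
      ... | yes sat = inj₂ (preserve n φ as sat)
      ... | no ¬sat = inj₁ (λ sol _ → ¬sat (_ , proj₁ (solutions-singleton ℳ φ _) sol))

      backward : FormulasDisjointOrPreserve ℳ 𝒩 mode → ExistentialsPreserve ℳ 𝒩 mode
      backward disjointOrPreserve n φ as (_ , sat) with disjointOrPreserve n φ as
      -- Disjointness from `U` denies `tt`, the membership of the given witness in the whole
      -- universe.
      ... | inj₁ disjoint = contradiction tt (disjoint (proj₂ (solutions-singleton ℳ φ _) sat))
      ... | inj₂ preserve = preserve

    formulas⇔finiteTypes :
      FormulasDisjointOrPreserve ℳ 𝒩 mode ⇔ FiniteTypesDisjointOrPreserve ℳ 𝒩 mode
    formulas⇔finiteTypes = mk⇔
      (λ formulas n Φ finite as →
        disjointOrPreserve-cong ℳ mode _ N (solutions-⋀ ℳ finite _)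
          (formulas n (⋀ (proj₁ finite)) as))
      -- A single formula is the finite type listed by `[ φ ]`.
      (λ types n φ → types n ｛ φ ｝ ([ φ ] , (λ { refl → here refl }) , λ { (here refl) → refl }))

corollary6p2 : ∀ {s ℓ} → ExcludedMiddle (s ⊔ ℓ) →
    {𝕊 : Signature s} (ℳ : Structure 𝕊 ℓ) (𝒩 : Substructure ℳ) (mode : Mode) →
    (ElementarySubstructure ℳ 𝒩 ⇔ ExistentialsPreserve ℳ 𝒩 mode) ×
    (ExistentialsPreserve ℳ 𝒩 mode ⇔ FormulasDisjointOrPreserve ℳ 𝒩 mode) ×
    (FormulasDisjointOrPreserve ℳ 𝒩 mode ⇔ FiniteTypesDisjointOrPreserve ℳ 𝒩 mode)
corollary6p2 {s} em ℳ 𝒩 mode =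
  elementary⇔preserve ℳ 𝒩 mode em′ ,
  preserve⇔disjointOrPreserve ℳ 𝒩 mode em′ ,
  formulas⇔finiteTypes ℳ 𝒩 mode
  where em′ = excludedMiddle-lower s em
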